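{- For all $n\ge 2$ we have $$\sum_{\pi\in F_n(123)} q^{\operatorname{inv}(\pi)}t^{\operatorname{lrmax}(\pi)}r^{\operatorname{afterone}(\pi)} = t\sum_{s=0}^{n-2} q^{s^2+s-ns+\binom n2}\genfrac{[}{]}{0pt}{}{n-2}{s}_q r^s + t^2\sum_{s=1}^{n-1} q^{s^2-ns+\binom n2}\genfrac{[}{]}{0pt}{}{n-2}{s-1}_q r^s .$$ In particular, $$\sum_{\pi\in F_n(123)} q^{\operatorname{inv}(\pi)}r^{\operatorname{afterone}(\pi)} = \sum_{s=0}^{n-1} q^{s^2-ns+\binom n2}\genfrac{[}{]}{0pt}{}{n-1}{s}_q r^s .$$
   Context: A Fishburn permutation is a permutation $\pi$ (in one-line notation) with no subsequence $\pi_j,\pi_{j+1},\pi_k$ such that $j+1<k$, $\pi_j=\pi_k+1$, and $\pi_{j+1}>\pi_j$. $F_n(123)$ is the set of Fishburn permutations of length $n$ with no increasing subsequence of length three (i.e. avoiding the classical pattern $123$). $\operatorname{inv}(\pi)$ is the number of pairs $(j,k)$ with $j<k$ and $\pi_j>\pi_k$; $\operatorname{lrmax}(\pi)$ is the number of left-to-right maxima (entries greater than all entries to their left); $\operatorname{afterone}(\pi)$ is the number of entries of $\pi$ to the right of the entry $1$. The $q$-binomial coefficient is $\genfrac{[}{]}{0pt}{}{n}{m}_q=\sum_{\alpha} q^{\operatorname{inv}(\alpha)}$, summed over binary sequences $\alpha$ of length $n$ with exactly $m$ ones, where $\operatorname{inv}(\alpha)$ is the number of pairs $j<k$ with $\alpha(j)=1$,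 $\alpha(k)=0$. -}

module Defs where

open import Algebra.Bundles using (CommutativeSemiring)
open import Data.Bool.Base using (Bool; true; false)
import Data.Bool.Properties as Bool
open import Data.Fin.Base using (Fin; toℕ)
import Data.Fin.Base as Fin
import Data.Fin.Properties as Fin
open import Data.List.Base
  using (List; []; _∷_; length; filter; foldr; allFin; cartesianProduct; cartesianProductWith; applyUpTo)
open import Data.List.Membership.Propositional using (_∈_)
open import Data.List.Membership.Propositional.Properties using (∈-cartesianProductWith⁺)
open import Data.List.Relation.Unary.All using ([])
open import Data.List.Relation.Unary.AllPairs using ([]; _∷_)
open import Data.List.Relation.Unary.Any using (here)
open import Data.List.Relation.Unary.Unique.Propositional using (Unique)
open import Data.List.Relation.Unary.Unique.Propositional.Properties using (cartesianProductWith⁺)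
open import Data.Nat.Base using (ℕ; zero; suc; _+_; _*_; _∸_; _^_; _<_; _≤_; z≤n)
open import Data.Nat.Combinatorics using (_C_; nC1≡n; nCk+nC[k+1]≡[n+1]C[k+1])
open import Data.Nat.Properties
open import Data.Product.Base using (∃-syntax; _×_; _,_; proj₁; proj₂)
open import Data.Vec.Base using (Vec; []; _∷_; lookup)
open import Data.Vec.Properties using (∷-injective)
open import Function.Definitions using (Injective)
open import Relation.Binary.PropositionalEquality using (_≡_; refl; sym; cong; subst)
open import Relation.Nullary using (¬_; Dec; map′; ¬?; _×-dec_; _→-dec_)
open import Relation.Unary using (Pred; Decidable)

count : ∀ {a p} {A : Set a} {P : Pred A p} → Decidable P → List A → ℕ
count P? xs = length (filter P? xs)

words : ∀ {a} {A : Set a} → List A → (n : ℕ) → List (Vec A n)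
words letters zero    = [] ∷ []
words letters (suc n) = cartesianProductWith _∷_ letters (words letters n)

words-complete : ∀ {a} {A : Set a} {letters : List A} → (∀ x → x ∈ letters) →
                 ∀ {n} (w : Vec A n) → w ∈ words letters n
words-complete all∈ []      = here refl
words-complete all∈ (x ∷ w) = ∈-cartesianProductWith⁺ _∷_ (all∈ x) (words-complete all∈ w)

words-unique : ∀ {a} {A : Set a} {letters : List A} → Unique letters →
               ∀ n → Unique (words letters n)
words-unique u zero    = [] ∷ []
words-unique u (suc n) = cartesianProductWith⁺ _∷_ ∷-injective u (words-unique u n)

-- One-line notation: the word π represents the permutation whose entries are
-- π ! j, with values in {1,…,n}; positions are numbered from 0.
infix 8 _!_
_!_ : ∀ {n} → Vec (Fin n) n → Fin n → ℕ
π ! j = suc (toℕ (lookup π j))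

-- An injective self-map of Fin n is a bijection.
IsPermutation : ∀ {n} → Vec (Fin n) n → Set
IsPermutation π = Injective _≡_ _≡_ (lookup π)

ContainsFishburnPattern : ∀ {n} → Vec (Fin n) n → Set
ContainsFishburnPattern π =
  ∃[ j ] ∃[ j′ ] ∃[ k ]
    (toℕ j′ ≡ suc (toℕ j) × j′ Fin.< k × π ! j ≡ π ! k + 1 × π ! j < π ! j′)

Contains123 : ∀ {n} → Vec (Fin n) n → Set
Contains123 π =
  ∃[ i ] ∃[ j ] ∃[ k ] (i Fin.< j × j Fin.< k × π ! i < π ! j × π ! j < π ! k)

Fishburn123 : ∀ {n} → Vec (Fin n) n → Set
Fishburn123 π = IsPermutation π × ¬ ContainsFishburnPattern π × ¬ Contains123 π

isPermutation? : ∀ {n} (π : Vec (Fin n) n) → Dec (IsPermutation π)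
isPermutation? π =
  map′ (λ f {i} {j} → f i j) (λ f i j → f {i} {j})
    (Fin.all? λ i → Fin.all? λ j → (lookup π i Fin.≟ lookup π j) →-dec (i Fin.≟ j))

containsFishburnPattern? : ∀ {n} (π : Vec (Fin n) n) → Dec (ContainsFishburnPattern π)
containsFishburnPattern? π =
  Fin.any? λ j → Fin.any? λ j′ → Fin.any? λ k →
    (toℕ j′ ≟ suc (toℕ j)) ×-dec (j′ Fin.<? k) ×-dec (π ! j ≟ π ! k + 1) ×-dec (π ! j <? π ! j′)

contains123? : ∀ {n} (π : Vec (Fin n) n) → Dec (Contains123 π)
contains123? π =
  Fin.any? λ i → Fin.any? λ j → Fin.any? λ k →
    (i Fin.<? j) ×-dec (j Fin.<? k) ×-dec (π ! i <? π ! j) ×-dec (π ! j <? π ! k)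

fishburn123? : ∀ {n} (π : Vec (Fin n) n) → Dec (Fishburn123 π)
fishburn123? π = isPermutation? π ×-dec ¬? (containsFishburnPattern? π) ×-dec ¬? (contains123? π)

F123 : (n : ℕ) → List (Vec (Fin n) n)
F123 n = filter fishburn123? (words (allFin n) n)

pairs : (n : ℕ) → List (Fin n × Fin n)
pairs n = cartesianProduct (allFin n) (allFin n)

inv : ∀ {n} → Vec (Fin n) n → ℕ
inv {n} π = count (λ (j , k) → (j Fin.<? k) ×-dec (π ! k <? π ! j)) (pairs n)

lrmax : ∀ {n} → Vec (Fin n) n → ℕ
lrmax {n} π =
  count (λ k → Fin.all? λ j → (j Fin.<? k) →-dec (π ! j <? π ! k)) (allFin n)

afterone : ∀ {n} → Vec (Fin n) n → ℕ
afterone {n} π =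
  count (λ k → Fin.any? λ j → (π ! j ≟ 1) ×-dec (j Fin.<? k)) (allFin n)

-- Binary sequences: true is the letter 1 and false the letter 0.
ones : ∀ {n} → Vec Bool n → ℕ
ones {n} α = count (λ j → lookup α j Bool.≟ true) (allFin n)

binaryInv : ∀ {n} → Vec Bool n → ℕ
binaryInv {n} α =
  count (λ (j , k) → (j Fin.<? k) ×-dec (lookup α j Bool.≟ true) ×-dec (lookup α k Bool.≟ false))
        (pairs n)

binarySequences : (n m : ℕ) → List (Vec Bool n)
binarySequences n m = filter (λ α → ones α ≟ m) (words (false ∷ true ∷ []) n)

-- The integers from a to b, both included.
range : ℕ → ℕ → List ℕ
range a b = applyUpTo (a +_) (suc b ∸ a)

-- Identities of polynomials with natural-number coefficients are stated as
-- identities between their values in an arbitrary commutative semiring; for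
-- the semiring ℕ[q,t,r] and its generators this is the formal identity itself.
module GeneratingFunctions {c ℓ} (R : CommutativeSemiring c ℓ) where
  open CommutativeSemiring R using (Carrier; 0#; semiring) renaming (_+_ to _⊕_)
  open import Algebra.Properties.Semiring.Exp semiring public using () renaming (_^_ to _^ᴿ_)

  ∑ : ∀ {a} {A : Set a} → List A → (A → Carrier) → Carrier
  ∑ xs f = foldr (λ x acc → f x ⊕ acc) 0# xs

  infix 5 ∑
  syntax ∑ xs (λ x → e) = ∑[ x ∈ xs ] e

  qBinomial : Carrier → ℕ → ℕ → Carrier
  qBinomial q n m = ∑[ α ∈ binarySequences n m ] (q ^ᴿ binaryInv α)

-- Truncated subtraction of n * s from s ^ 2 + n C 2, or from anything larger,
-- is therefore genuine subtraction.
s*d≤[s+d]C2 : ∀ s d → s * d ≤ (s + d) C 2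
s*d≤[s+d]C2 zero    d = z≤n
s*d≤[s+d]C2 (suc s) d = begin
  d + s * d                          ≤⟨ +-mono-≤ (m≤n+m d s) (s*d≤[s+d]C2 s d) ⟩
  (s + d) + (s + d) C 2              ≡⟨ cong (_+ (s + d) C 2) (sym (nC1≡n (s + d))) ⟩
  (s + d) C 1 + (s + d) C 2          ≡⟨ nCk+nC[k+1]≡[n+1]C[k+1] (s + d) 1 ⟩
  (suc s + d) C 2                    ∎
  where open ≤-Reasoning

exponent-exact : ∀ {n s} → s ≤ n → n * s ≤ s ^ 2 + n C 2
exponent-exact {n} {s} s≤n = subst (λ m → m * s ≤ s ^ 2 + m C 2) (m+[n∸m]≡n s≤n) (begin
  (s + d) * s                        ≡⟨ *-comm (s + d) s ⟩
  s * (s + d)                        ≡⟨ *-distribˡ-+ s s d ⟩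
  s * s + s * d                      ≤⟨ +-monoʳ-≤ (s * s) (s*d≤[s+d]C2 s d) ⟩
  s * s + (s + d) C 2                ≡⟨ cong (λ m → s * m + (s + d) C 2) (sym (*-identityʳ s)) ⟩
  s ^ 2 + (s + d) C 2                ∎)
  where
  open ≤-Reasoning
  d = n ∸ s

{-# OPTIONS --safe #-}
module Submission where

-- Let π be a Fishburn permutation avoiding 123. The entries after 1 decrease,
-- for an ascent among them would form a 123 with 1. The entries before 1 also
-- decrease: if a < b were adjacent there, then a − 1 is either to the right of
-- b, giving the Fishburn pattern, or to the left of a, giving a 123. Conversely
-- every T↓ 1 S↓ with T ⊎ S = {2,…,n} is such a permutation. Let α be the word on
-- {2,…,n} whose ones are the elements of S, and s = |S|. The non-inversions of π
-- are the s pairs (1,b) and the pairs a < b with a ∈ T, b ∈ S; of the s(n−1−s)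
-- pairs in T × S all but inv(α) are of the latter kind, hence
-- inv(π) = C(n,2) − s − s(n−1−s) + inv(α). The last letter of α tells whether
-- n ∈ S, that is, whether π has two left-to-right maxima or one.

open import Algebra.Bundles using (CommutativeSemiring)
open import Data.Bool.Base using (Bool; true; false; if_then_else_; _∧_; T)
import Data.Bool.Properties as Bool
open import Data.Fin.Base as Fin using (Fin; zero; suc; toℕ; fromℕ; inject₁; punchIn; punchOut)
open import Data.Fin.Induction using (<-wellFounded)
import Data.Fin.Properties as Fin
open import Data.List.Base as List
  using (List; []; _∷_; filter; tabulate; allFin; applyUpTo; cartesianProduct)
open import Data.List.Membership.Propositional using (_∈_)
open import Data.List.Membership.Propositional.Properties
  using (∈-map⁺; ∈-map⁻; ∈-filter⁺; ∈-filter⁻; ∈-allFin)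
open import Data.List.Membership.Propositional.Properties.WithK using (unique∧set⇒bag)
open import Data.List.Relation.Binary.BagAndSetEquality using (∼bag⇒↭)
open import Data.List.Relation.Binary.Permutation.Propositional as Perm using (_↭_)
open import Data.List.Relation.Unary.All using ([]; _∷_)
open import Data.List.Relation.Unary.AllPairs using ([]; _∷_)
open import Data.List.Relation.Unary.Any using (here; there)
open import Data.List.Relation.Unary.Unique.Propositional using (Unique)
import Data.List.Relation.Unary.Unique.Propositional.Properties as Unique
open import Data.Nat.Base as ℕ using (ℕ; zero; suc; _≤_; _<_; _<ᵇ_; _∸_; z≤n; s≤s)
open import Data.Nat.Combinatorics using (_C_; nC1≡n; nCk+nC[k+1]≡[n+1]C[k+1])
import Data.Nat.Properties as ℕ
open import Data.Nat.Tactic.RingSolver using (solve-∀)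
open import Data.Product.Base using (∃-syntax; _×_; _,_; proj₁; proj₂)
open import Data.Sum.Base using (_⊎_; inj₁; inj₂)
open import Data.Vec.Base as Vec using (Vec; []; _∷_; lookup; insertAt; _∷ʳ_)
open import Data.Vec.Properties
  using (insertAt-lookup; insertAt-punchIn; lookup-map; lookup∘tabulate; tabulate∘lookup; tabulate-cong)
open import Function.Base using (_∘_; id)
open import Function.Bundles using (mk⇔)
open import Induction.WellFounded using (Acc; acc)
open import Relation.Binary.Definitions using (Tri; tri<; tri≈; tri>)
open import Relation.Binary.PropositionalEquality as ≡ using (_≡_; _≢_)
open import Relation.Nullary using (¬_; Dec; yes; no; does; contradiction)
open import Relation.Nullary.Decidable using (dec-true; dec-false; does-⇔; _×-dec_; _→-dec_)
open import Relation.Unary using (Pred; Decidable)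
open import Defs

module Arrangements where

  open import Algebra.Properties.CommutativeMonoid.Sum ℕ.+-0-commutativeMonoid
    using (sum; sum-remove; sum-cong-≗; ∑-distrib-+; sum-replicate-zero)
  open import Algebra.Properties.CommutativeSemigroup ℕ.+-commutativeSemigroup
    using (x∙yz≈y∙xz; xy∙z≈xz∙y)
  open import Data.Nat.Base using (_+_; _*_; _^_)
  open import Data.Nat.Properties
  open ≡ using (refl; sym; trans; cong; cong₂; subst; subst₂; ≢-sym; module ≡-Reasoning)

  -- Counts as sums of indicators.

  𝟙 : Bool → ℕ
  𝟙 b = if b then 1 else 0

  module _ {a p} {A : Set a} {P : Pred A p} (P? : Decidable P) where

    count-∷ : ∀ x xs → count P? (x ∷ xs) ≡ 𝟙 (does (P? x)) + count P? xs
    count-∷ x xs with does (P? x)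
    ... | true  = refl
    ... | false = refl

    count-++ : ∀ xs ys → count P? (xs List.++ ys) ≡ count P? xs + count P? ys
    count-++ []       ys = refl
    count-++ (x ∷ xs) ys with does (P? x)
    ... | true  = cong suc (count-++ xs ys)
    ... | false = count-++ xs ys

    count-map : ∀ {b} {B : Set b} (f : B → A) xs → count P? (List.map f xs) ≡ count (P? ∘ f) xs
    count-map f []       = refl
    count-map f (x ∷ xs) with does (P? (f x))
    ... | true  = cong suc (count-map f xs)
    ... | false = count-map f xs

    count-tabulate : ∀ {n} (f : Fin n → A) →
                     count P? (tabulate f) ≡ sum (λ i → 𝟙 (does (P? (f i))))
    count-tabulate {zero}  f = refl
    count-tabulate {suc n} f =
      trans (count-∷ (f zero) _) (cong (𝟙 (does (P? (f zero))) +_) (count-tabulate (f ∘ suc)))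

  count-cartesianProduct :
    ∀ {a b p} {A : Set a} {B : Set b} {P : Pred (A × B) p} (P? : Decidable P)
    {m n} (f : Fin m → A) (g : Fin n → B) →
    count P? (cartesianProduct (tabulate f) (tabulate g)) ≡
    sum (λ i → sum (λ j → 𝟙 (does (P? (f i , g j)))))
  count-cartesianProduct P? {zero}  f g = refl
  count-cartesianProduct P? {suc m} f g = begin
    count P? (List.map (f zero ,_) (tabulate g) List.++ rest)
      ≡⟨ count-++ P? (List.map (f zero ,_) (tabulate g)) rest ⟩
    count P? (List.map (f zero ,_) (tabulate g)) + count P? rest
      ≡⟨ cong₂ _+_ (trans (count-map P? (f zero ,_) (tabulate g))
                          (count-tabulate (λ y → P? (f zero , y)) g))
                   (count-cartesianProduct P? (f ∘ suc) g) ⟩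
    _ ∎
    where
    open ≡-Reasoning
    rest = cartesianProduct (tabulate (f ∘ suc)) (tabulate g)

  -- Inversions, and the insertion of a new least entry.

  inverted : ∀ {n} → Vec (Fin n) n → Fin n → Fin n → ℕ
  inverted π j k = 𝟙 ((toℕ j <ᵇ toℕ k) ∧ (toℕ (lookup π k) <ᵇ toℕ (lookup π j)))

  inversions : ∀ {n} → Vec (Fin n) n → Fin n → ℕ
  inversions π j = sum (inverted π j)

  inv≡sum : ∀ {n} (π : Vec (Fin n) n) → inv π ≡ sum (inversions π)
  inv≡sum {n} π = count-cartesianProduct
    (λ (j , k) → (j Fin.<? k) ×-dec (π ! k <? π ! j)) {n} {n} id id

  -- After an insertion at p, lookups are computed only at p and at the positions `punchIn p i`;
  -- these exhaust all positions.
  punchIn-elim : ∀ {a n} (p : Fin (suc n)) (P : Fin (suc n) → Set a) →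
                 P p → (∀ i → P (punchIn p i)) → ∀ j → P j
  punchIn-elim p P at-p away j with p Fin.≟ j
  ... | yes refl = at-p
  ... | no  p≢j  = subst P (Fin.punchIn-punchOut p≢j) (away (punchOut p≢j))

  punchIn-<ᵇ : ∀ {n} (p : Fin (suc n)) i j →
               (toℕ (punchIn p i) <ᵇ toℕ (punchIn p j)) ≡ (toℕ i <ᵇ toℕ j)
  punchIn-<ᵇ zero    i       j       = refl
  punchIn-<ᵇ (suc p) zero    zero    = refl
  punchIn-<ᵇ (suc p) zero    (suc j) = refl
  punchIn-<ᵇ (suc p) (suc i) zero    = refl
  punchIn-<ᵇ (suc p) (suc i) (suc j) = punchIn-<ᵇ p i j

  punchIn-<ᵇ-pivot : ∀ {n} (p : Fin (suc n)) i → (toℕ (punchIn p i) <ᵇ toℕ p) ≡ (toℕ i <ᵇ toℕ p)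
  punchIn-<ᵇ-pivot zero    i       = refl
  punchIn-<ᵇ-pivot (suc p) zero    = refl
  punchIn-<ᵇ-pivot (suc p) (suc i) = punchIn-<ᵇ-pivot p i

  -- `punchIn p` moves i up by one exactly when p ≤ i; the `suc` expresses this weak inequality
  -- through `<ᵇ`.
  pivot-<ᵇ-punchIn : ∀ {n} (p : Fin (suc n)) i → (toℕ p <ᵇ toℕ (punchIn p i)) ≡ (toℕ p <ᵇ suc (toℕ i))
  pivot-<ᵇ-punchIn zero    i       = refl
  pivot-<ᵇ-punchIn (suc p) zero    = refl
  pivot-<ᵇ-punchIn (suc p) (suc i) = pivot-<ᵇ-punchIn p i

  sum-below : ∀ {n} (p : Fin (suc n)) → sum {n} (λ i → 𝟙 (toℕ i <ᵇ toℕ p)) ≡ toℕ p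
  sum-below {n}     zero    = sum-replicate-zero n
  sum-below {suc n} (suc p) = cong suc (sum-below p)

  sum-above : ∀ {n} (p : Fin (suc n)) → sum {n} (λ i → 𝟙 (toℕ p <ᵇ suc (toℕ i))) + toℕ p ≡ n
  sum-above {zero}  zero    = refl
  sum-above {suc n} zero    = cong suc (sum-above {n} zero)
  sum-above {suc n} (suc p) = trans (+-suc _ (toℕ p)) (cong suc (sum-above p))

  <ᵇ-true : ∀ {m n} → m < n → (m <ᵇ n) ≡ true
  <ᵇ-true {m} {n} = dec-true (m <? n)

  <ᵇ-false : ∀ {m n} → n ≤ m → (m <ᵇ n) ≡ false
  <ᵇ-false {m} {n} n≤m = dec-false (m <? n) (≤⇒≯ n≤m)

  <ᵇ-true⁻ : ∀ {m n} → (m <ᵇ n) ≡ true → m < n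
  <ᵇ-true⁻ {m} {n} eq = <ᵇ⇒< m n (subst T (sym eq) _)

  -- The value `zero` is the entry 1 of the one-line notation. Growing a permutation at its least
  -- value matches the recursion on a word whose head marks the least value, and each statistic then
  -- changes in a way governed by p.
  insertMin : ∀ {n} → Fin (suc n) → Vec (Fin n) n → Vec (Fin (suc n)) (suc n)
  insertMin p π = insertAt (Vec.map suc π) p zero

  module _ {n} (p : Fin (suc n)) (π : Vec (Fin n) n) where

    lookup-insertMin-pivot : lookup (insertMin p π) p ≡ zero
    lookup-insertMin-pivot = insertAt-lookup (Vec.map suc π) p zero

    lookup-insertMin-punchIn : ∀ i → lookup (insertMin p π) (punchIn p i) ≡ suc (lookup π i)
    lookup-insertMin-punchIn i =
      trans (insertAt-punchIn (Vec.map suc π) p zero i) (lookup-map i suc π)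

    -- The least entry is inverted with each of the p entries to its left and with none to its
    -- right; all other pairs keep their relative order.
    inv-insertMin : inv (insertMin p π) ≡ toℕ p + inv π
    inv-insertMin = begin
      inv ρ
        ≡⟨ trans (inv≡sum ρ) (sum-remove {n} {p} (inversions ρ)) ⟩
      inversions ρ p + sum (λ i → inversions ρ (punchIn p i))
        ≡⟨ cong₂ _+_ row-p (trans (sum-cong-≗ row) (∑-distrib-+ {n} below (inversions π))) ⟩
      sum below + sum (inversions π)
        ≡⟨ cong₂ _+_ (sum-below p) (sym (inv≡sum π)) ⟩
      toℕ p + inv π ∎
      where
      open ≡-Reasoning
      ρ = insertMin p π

      below : Fin n → ℕ
      below i = 𝟙 (toℕ i <ᵇ toℕ p)

      row-p : inversions ρ p ≡ 0
      row-p = trans (sum-cong-≗ entry) (sum-replicate-zero (suc n))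
        where
        entry : ∀ k → inverted ρ p k ≡ 0
        entry k rewrite lookup-insertMin-pivot = cong 𝟙 (Bool.∧-zeroʳ (toℕ p <ᵇ toℕ k))

      row : ∀ i → inversions ρ (punchIn p i) ≡ below i + inversions π i
      row i = trans (sum-remove {n} {p} (inverted ρ (punchIn p i))) (cong₂ _+_ column-p (sum-cong-≗ entry))
        where
        column-p : inverted ρ (punchIn p i) p ≡ below i
        column-p rewrite lookup-insertMin-pivot | lookup-insertMin-punchIn i | punchIn-<ᵇ-pivot p i
          = cong 𝟙 (Bool.∧-identityʳ _)
        entry : ∀ k → inverted ρ (punchIn p i) (punchIn p k) ≡ inverted π i k
        entry k rewrite lookup-insertMin-punchIn i | lookup-insertMin-punchIn k | punchIn-<ᵇ p i k = refl

    -- The least entry is a left-to-right maximum only in first position, and it never keeps a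
    -- larger entry from being one.
    lrmax-insertMin : lrmax (insertMin p π) ≡ 𝟙 (toℕ p <ᵇ 1) + lrmax π
    lrmax-insertMin = begin
      lrmax ρ
        ≡⟨ count-tabulate max? id ⟩
      sum (λ k → 𝟙 (does (max? k)))
        ≡⟨ sum-remove {i = p} (λ k → 𝟙 (does (max? k))) ⟩
      𝟙 (does (max? p)) + sum (λ i → 𝟙 (does (max? (punchIn p i))))
        ≡⟨ cong₂ (λ b s → 𝟙 b + s) at-p (sum-cong-≗ (cong 𝟙 ∘ away)) ⟩
      𝟙 (toℕ p <ᵇ 1) + sum (λ i → 𝟙 (does (max′? i)))
        ≡⟨ cong (𝟙 (toℕ p <ᵇ 1) +_) (sym (count-tabulate max′? id)) ⟩
      𝟙 (toℕ p <ᵇ 1) + lrmax π ∎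
      where
      open ≡-Reasoning
      ρ = insertMin p π
      max? : ∀ k → Dec (∀ j → j Fin.< k → ρ ! j < ρ ! k)
      max? k = Fin.all? λ j → (j Fin.<? k) →-dec (ρ ! j <? ρ ! k)

      max′? : ∀ k → Dec (∀ j → j Fin.< k → π ! j < π ! k)
      max′? k = Fin.all? λ j → (j Fin.<? k) →-dec (π ! j <? π ! k)

      at-p : does (max? p) ≡ (toℕ p <ᵇ 1)
      at-p = does-⇔ (mk⇔ to from) (max? p) (toℕ p <? 1)
        where
        to : (∀ j → j Fin.< p → ρ ! j < ρ ! p) → toℕ p < 1
        -- If p were positive, position 0 would have to hold a value below `zero`.
        to h = ≰⇒> λ 0<p →
          n≮0 (ℕ.s≤s⁻¹ (subst (λ v → ρ ! zero < suc (toℕ v)) lookup-insertMin-pivot (h zero 0<p)))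
        from : toℕ p < 1 → ∀ j → j Fin.< p → ρ ! j < ρ ! p
        from p<1 j j<p = contradiction (<-≤-trans j<p (ℕ.s≤s⁻¹ p<1)) n≮0

      away : ∀ i → does (max? (punchIn p i)) ≡ does (max′? i)
      away i = does-⇔ (mk⇔ to from) (max? (punchIn p i)) (max′? i)
        where
        to : (∀ j → j Fin.< punchIn p i → ρ ! j < ρ ! punchIn p i) → ∀ j → j Fin.< i → π ! j < π ! i
        to h j j<i = ℕ.s≤s⁻¹ (subst₂ (λ u v → suc (toℕ u) < suc (toℕ v))
          (lookup-insertMin-punchIn j) (lookup-insertMin-punchIn i)
          (h (punchIn p j) (<ᵇ-true⁻ (trans (punchIn-<ᵇ p j i) (<ᵇ-true j<i)))))
        from : (∀ j → j Fin.< i → π ! j < π ! i) → ∀ j → j Fin.< punchIn p i → ρ ! j < ρ ! punchIn p i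
        from h = punchIn-elim p _
          (λ _ → subst₂ (λ u v → suc (toℕ u) < suc (toℕ v))
            (sym lookup-insertMin-pivot) (sym (lookup-insertMin-punchIn i)) (s≤s (s≤s z≤n)))
          (λ j j<i → subst₂ (λ u v → suc (toℕ u) < suc (toℕ v))
            (sym (lookup-insertMin-punchIn j)) (sym (lookup-insertMin-punchIn i))
            (s≤s (h j (<ᵇ-true⁻ (trans (sym (punchIn-<ᵇ p j i)) (<ᵇ-true j<i))))))

    -- The entry 1 is the inserted one, so the positions beyond p are counted. Adding p on the left
    -- avoids truncated subtraction.
    afterone-insertMin : afterone (insertMin p π) + toℕ p ≡ n
    afterone-insertMin = begin
      afterone ρ + toℕ p
        ≡⟨ cong (_+ toℕ p) (trans (count-tabulate after? {suc n} id)
             (trans (sum-cong-≗ (cong 𝟙 ∘ after-p)) (sum-remove {n} {p} (λ k → 𝟙 (toℕ p <ᵇ toℕ k))))) ⟩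
      𝟙 (toℕ p <ᵇ toℕ p) + sum (λ i → 𝟙 (toℕ p <ᵇ toℕ (punchIn p i))) + toℕ p
        ≡⟨ cong (_+ toℕ p) (cong₂ (λ b s → 𝟙 b + s) (<ᵇ-false (≤-refl {toℕ p}))
             (sum-cong-≗ {n} (cong 𝟙 ∘ pivot-<ᵇ-punchIn p))) ⟩
      sum {n} (λ i → 𝟙 (toℕ p <ᵇ suc (toℕ i))) + toℕ p
        ≡⟨ sum-above p ⟩
      n ∎
      where
      open ≡-Reasoning
      ρ = insertMin p π
      after? : ∀ k → Dec (∃[ j ] (ρ ! j ≡ 1 × j Fin.< k))
      after? k = Fin.any? λ j → (ρ ! j ≟ 1) ×-dec (j Fin.<? k)

      after-p : ∀ k → does (after? k) ≡ (toℕ p <ᵇ toℕ k)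
      after-p k = does-⇔ (mk⇔ to from) (after? k) (toℕ p <? toℕ k)
        where
        to : ∃[ j ] (ρ ! j ≡ 1 × j Fin.< k) → p Fin.< k
        to (j , ρj≡1 , j<k) = punchIn-elim p (λ j → ρ ! j ≡ 1 → j Fin.< k → p Fin.< k)
          (λ _ p<k → p<k)
          (λ i eq _ → contradiction (trans (sym (cong (suc ∘ toℕ) (lookup-insertMin-punchIn i))) eq) λ ())
          j ρj≡1 j<k
        from : p Fin.< k → ∃[ j ] (ρ ! j ≡ 1 × j Fin.< k)
        from p<k = p , cong (suc ∘ toℕ) lookup-insertMin-pivot , p<k

  -- Zeros, ones and inversions of binary words.

  zeros : ∀ {n} → Vec Bool n → Fin (suc n)
  zeros []          = zero
  zeros (false ∷ β) = suc (zeros β)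
  -- Only the bound grows here: the count lives in `Fin (suc n)` because it serves as an insertion
  -- position.
  zeros (true  ∷ β) = inject₁ (zeros β)

  zeros-∷ʳ-false : ∀ {n} (β : Vec Bool n) → toℕ (zeros (β ∷ʳ false)) ≡ suc (toℕ (zeros β))
  zeros-∷ʳ-false []          = refl
  zeros-∷ʳ-false (false ∷ β) = cong suc (zeros-∷ʳ-false β)
  zeros-∷ʳ-false (true  ∷ β)
    rewrite Fin.toℕ-inject₁ (zeros (β ∷ʳ false)) | Fin.toℕ-inject₁ (zeros β) = zeros-∷ʳ-false β

  ones-∷ : ∀ {n} b (β : Vec Bool n) → ones (b ∷ β) ≡ 𝟙 b + ones β
  ones-∷ {n} b β = trans (count-tabulate (λ j → lookup (b ∷ β) j Bool.≟ true) {suc n} id)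
    (cong₂ _+_ (head b) (sym (count-tabulate (λ j → lookup β j Bool.≟ true) {n} id)))
    where
    head : ∀ b → 𝟙 (does (b Bool.≟ true)) ≡ 𝟙 b
    head false = refl
    head true  = refl

  ones+zeros : ∀ {n} (β : Vec Bool n) → ones β + toℕ (zeros β) ≡ n
  ones+zeros []          = refl
  ones+zeros (false ∷ β) = trans (cong (_+ suc (toℕ (zeros β))) (ones-∷ false β))
    (trans (+-suc (ones β) _) (cong suc (ones+zeros β)))
  ones+zeros (true  ∷ β) =
    trans (cong₂ _+_ (ones-∷ true β) (Fin.toℕ-inject₁ (zeros β))) (cong suc (ones+zeros β))

  ones-∷ʳ : ∀ {n} (β : Vec Bool n) b → ones (β ∷ʳ b) ≡ 𝟙 b + ones β
  ones-∷ʳ []      b = ones-∷ b []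
  ones-∷ʳ (c ∷ β) b = begin
    ones (c ∷ (β ∷ʳ b))    ≡⟨ ones-∷ c (β ∷ʳ b) ⟩
    𝟙 c + ones (β ∷ʳ b)    ≡⟨ cong (𝟙 c +_) (ones-∷ʳ β b) ⟩
    𝟙 c + (𝟙 b + ones β)   ≡⟨ x∙yz≈y∙xz (𝟙 c) (𝟙 b) (ones β) ⟩
    𝟙 b + (𝟙 c + ones β)   ≡⟨ cong (𝟙 b +_) (sym (ones-∷ c β)) ⟩
    𝟙 b + ones (c ∷ β)     ∎
    where
    open ≡-Reasoning

  sum-zeros : ∀ {n} (β : Vec Bool n) → sum (λ k → 𝟙 (does (lookup β k Bool.≟ false))) ≡ toℕ (zeros β)
  sum-zeros []          = refl
  sum-zeros (false ∷ β) = cong suc (sum-zeros β)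
  sum-zeros (true  ∷ β) = trans (sum-zeros β) (sym (Fin.toℕ-inject₁ (zeros β)))

  binaryInv≡sum : ∀ {n} (β : Vec Bool n) → binaryInv β ≡
    sum (λ j → sum (λ k → 𝟙 ((toℕ j <ᵇ toℕ k) ∧
      (does (lookup β j Bool.≟ true) ∧ does (lookup β k Bool.≟ false)))))
  binaryInv≡sum {n} β = count-cartesianProduct
    (λ (j , k) → (j Fin.<? k) ×-dec (lookup β j Bool.≟ true) ×-dec (lookup β k Bool.≟ false)) {n} {n} id id

  binaryInv-∷-false : ∀ {n} (β : Vec Bool n) → binaryInv (false ∷ β) ≡ binaryInv β
  binaryInv-∷-false {n} β = trans (binaryInv≡sum (false ∷ β))
    (cong₂ _+_ (sum-replicate-zero n) (sym (binaryInv≡sum β)))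

  binaryInv-∷-true : ∀ {n} (β : Vec Bool n) → binaryInv (true ∷ β) ≡ toℕ (zeros β) + binaryInv β
  binaryInv-∷-true β = trans (binaryInv≡sum (true ∷ β))
    (cong₂ _+_ (sum-zeros β) (sym (binaryInv≡sum β)))

  binaryInv-∷ʳ-true : ∀ {n} (β : Vec Bool n) → binaryInv (β ∷ʳ true) ≡ binaryInv β
  binaryInv-∷ʳ-true []          = refl
  binaryInv-∷ʳ-true (false ∷ β) =
    trans (binaryInv-∷-false (β ∷ʳ true)) (trans (binaryInv-∷ʳ-true β) (sym (binaryInv-∷-false β)))
  binaryInv-∷ʳ-true (true  ∷ β) =
    trans (binaryInv-∷-true (β ∷ʳ true))
      (trans (cong₂ _+_ zeros-∷ʳ-true (binaryInv-∷ʳ-true β)) (sym (binaryInv-∷-true β)))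
    where
    zeros-∷ʳ-true : toℕ (zeros (β ∷ʳ true)) ≡ toℕ (zeros β)
    -- The new letter raises both the ones and the length by one, so `ones+zeros` leaves the zeros
    -- unchanged.
    zeros-∷ʳ-true = +-cancelˡ-≡ (suc (ones β)) _ _ (begin
      suc (ones β) + toℕ (zeros (β ∷ʳ true))     ≡⟨ cong (_+ toℕ (zeros (β ∷ʳ true))) (sym (ones-∷ʳ β true)) ⟩
      ones (β ∷ʳ true) + toℕ (zeros (β ∷ʳ true)) ≡⟨ ones+zeros (β ∷ʳ true) ⟩
      suc _                                      ≡⟨ cong suc (sym (ones+zeros β)) ⟩
      suc (ones β) + toℕ (zeros β)               ∎)
      where open ≡-Reasoning

  -- The final 0 is inverted with every 1 before it. In the induction a leading 1 sees one zero more
  -- than before.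
  binaryInv-∷ʳ-false : ∀ {n} (β : Vec Bool n) → binaryInv (β ∷ʳ false) ≡ ones β + binaryInv β
  binaryInv-∷ʳ-false []          = refl
  binaryInv-∷ʳ-false (false ∷ β) = trans (binaryInv-∷-false (β ∷ʳ false))
    (trans (binaryInv-∷ʳ-false β) (sym (cong₂ _+_ (ones-∷ false β) (binaryInv-∷-false β))))
  binaryInv-∷ʳ-false (true  ∷ β) = begin
    binaryInv (true ∷ (β ∷ʳ false))
      ≡⟨ binaryInv-∷-true (β ∷ʳ false) ⟩
    toℕ (zeros (β ∷ʳ false)) + binaryInv (β ∷ʳ false)
      ≡⟨ cong₂ _+_ (zeros-∷ʳ-false β) (binaryInv-∷ʳ-false β) ⟩
    suc (toℕ (zeros β) + (ones β + binaryInv β))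
      ≡⟨ cong suc (x∙yz≈y∙xz (toℕ (zeros β)) (ones β) (binaryInv β)) ⟩
    suc (ones β) + (toℕ (zeros β) + binaryInv β)
      ≡⟨ sym (cong₂ _+_ (ones-∷ true β) (binaryInv-∷-true β)) ⟩
    ones (true ∷ β) + binaryInv (true ∷ β) ∎
    where
    open ≡-Reasoning

  -- The arrangement of a word, characterised by an order on values.

  slot : ∀ {n} → Bool → Vec Bool n → Fin (suc n)
  -- The least value closes its own decreasing block: it stands behind all larger false values, or
  -- at the very end.
  slot     false β = zeros β
  slot {n} true  β = fromℕ n

  -- The values marked false in decreasing order, followed by the values marked
  -- true in decreasing order: the head of the word marks the least value.
  arrange : ∀ {n} → Vec Bool n → Vec (Fin n) n
  arrange []      = []
  arrange (b ∷ β) = insertMin (slot b β) (arrange β)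

  -- The false block fills the first `zeros β` positions, so the position alone tells the letter. In
  -- the induction a false least value extends that block by one, while a true one is put last.
  lookup-arrange : ∀ {n} (β : Vec Bool n) j →
                   lookup β (lookup (arrange β) j) ≡ (toℕ (zeros β) <ᵇ suc (toℕ j))
  lookup-arrange {suc n} (false ∷ β) = punchIn-elim p _
    (trans (cong (lookup (false ∷ β)) (lookup-insertMin-pivot p π)) (sym (<ᵇ-false (≤-refl {suc (toℕ p)}))))
    (λ i → begin
      lookup (false ∷ β) (lookup (insertMin p π) (punchIn p i))
        ≡⟨ cong (lookup (false ∷ β)) (lookup-insertMin-punchIn p π i) ⟩
      lookup β (lookup π i)           ≡⟨ lookup-arrange β i ⟩
      (toℕ p <ᵇ suc (toℕ i))          ≡⟨ sym (pivot-<ᵇ-punchIn p i) ⟩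
      (toℕ p <ᵇ toℕ (punchIn p i))    ∎)
    where
    open ≡-Reasoning
    p = zeros β
    π = arrange β
  lookup-arrange {suc n} (true ∷ β) = punchIn-elim p _
    (trans (cong (lookup (true ∷ β)) (lookup-insertMin-pivot p π)) (sym (<ᵇ-true z<p)))
    (λ i → begin
      lookup (true ∷ β) (lookup (insertMin p π) (punchIn p i))
        ≡⟨ cong (lookup (true ∷ β)) (lookup-insertMin-punchIn p π i) ⟩
      lookup β (lookup π i)           ≡⟨ lookup-arrange β i ⟩
      (toℕ (zeros β) <ᵇ suc (toℕ i))
        ≡⟨ cong₂ (λ x y → x <ᵇ suc y) (sym (Fin.toℕ-inject₁ (zeros β))) (sym (punchIn-last i)) ⟩
      (toℕ (inject₁ (zeros β)) <ᵇ suc (toℕ (punchIn p i)))    ∎)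
    where
    open ≡-Reasoning
    p = fromℕ n
    π = arrange β
    z<p : toℕ (inject₁ (zeros β)) < suc (toℕ (fromℕ n))
    z<p = s≤s (subst₂ _≤_ (sym (Fin.toℕ-inject₁ (zeros β))) (sym (Fin.toℕ-fromℕ n)) (Fin.toℕ≤pred[n] (zeros β)))
    punchIn-last : ∀ {n} (i : Fin n) → toℕ (punchIn (fromℕ n) i) ≡ toℕ i
    punchIn-last zero    = refl
    punchIn-last (suc i) = cong suc (punchIn-last i)

  -- The strict order in which `arrange β` lists the values: larger first within a block, and the
  -- false block before the true one. It describes the arrangement without recursion.
  Precedes : ∀ {n} → Vec Bool n → Fin n → Fin n → Set
  Precedes β u v = (lookup β u ≡ lookup β v × v Fin.< u) ⊎ (lookup β u ≡ false × lookup β v ≡ true)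

  Sorted : ∀ {n} → Vec Bool n → Vec (Fin n) n → Set
  Sorted β π = ∀ {j k} → j Fin.< k → Precedes β (lookup π j) (lookup π k)

  precedes-asym : ∀ {n} (β : Vec Bool n) {u v} → Precedes β u v → ¬ Precedes β v u
  precedes-asym β (inj₁ (_ , v<u)) (inj₁ (_ , u<v)) = <-asym u<v v<u
  precedes-asym β (inj₁ (e , _))   (inj₂ (f , t))   = contradiction (trans (sym f) (trans (sym e) t)) λ ()
  precedes-asym β (inj₂ (f , t))   (inj₁ (e , _))   = contradiction (trans (sym f) (trans (sym e) t)) λ ()
  precedes-asym β (inj₂ (f , _))   (inj₂ (_ , t))   = contradiction (trans (sym f) t) λ ()

  -- A repeated value would precede itself, against asymmetry.
  sorted⇒permutation : ∀ {n} (β : Vec Bool n) π → Sorted β π → IsPermutation π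
  sorted⇒permutation β π sorted {i} {j} eq with Fin.<-cmp i j
  ... | tri≈ _ i≡j _ = i≡j
  ... | tri< i<j _ _ = contradiction (subst₂ (Precedes β) eq (sym eq) (sorted i<j)) (precedes-asym β (sorted i<j))
  ... | tri> _ _ j<i = contradiction (subst₂ (Precedes β) (sym eq) eq (sorted j<i)) (precedes-asym β (sorted j<i))

  -- Only pairs with the new value `zero` need care. Behind it there are only true values, and then
  -- it is false itself; a value before it is larger and in the same block, or false while `zero` is
  -- true.
  arrange-sorted : ∀ {n} (β : Vec Bool n) → Sorted β (arrange β)
  arrange-sorted {suc n} (b ∷ β) {j} {k} = punchIn-elim p
    (λ j → j Fin.< k → Precedes (b ∷ β) (lookup ρ j) (lookup ρ k))
    (punchIn-elim p (λ k → p Fin.< k → Precedes (b ∷ β) (lookup ρ p) (lookup ρ k))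
      (λ p<p → contradiction p<p (<-irrefl refl))
      (λ i p<i → subst₂ (Precedes (b ∷ β)) (sym (lookup-insertMin-pivot p π))
        (sym (lookup-insertMin-punchIn p π i)) (after b i p<i)) k)
    (λ i → punchIn-elim p
      (λ k → punchIn p i Fin.< k → Precedes (b ∷ β) (lookup ρ (punchIn p i)) (lookup ρ k))
      (λ i<p → subst₂ (Precedes (b ∷ β)) (sym (lookup-insertMin-punchIn p π i))
        (sym (lookup-insertMin-pivot p π)) (before b i i<p))
      (λ k i<k → subst₂ (Precedes (b ∷ β)) (sym (lookup-insertMin-punchIn p π i))
        (sym (lookup-insertMin-punchIn p π k))
        (shift (arrange-sorted β (<ᵇ-true⁻ (trans (sym (punchIn-<ᵇ p i k)) (<ᵇ-true i<k)))))) k)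
    j
    where
    p = slot b β
    π = arrange β
    ρ = insertMin p π

    shift : ∀ {u v} → Precedes β u v → Precedes (b ∷ β) (suc u) (suc v)
    shift (inj₁ (e , v<u)) = inj₁ (e , s≤s v<u)
    shift (inj₂ ft)        = inj₂ ft

    after : ∀ b i → slot b β Fin.< punchIn (slot b β) i → Precedes (b ∷ β) zero (suc (lookup π i))
    after false i p<i = inj₂ (refl ,
      trans (lookup-arrange β i) (trans (sym (pivot-<ᵇ-punchIn (zeros β) i)) (<ᵇ-true p<i)))
    after true  i p<i = contradiction (≤-trans p<i (Fin.toℕ≤pred[n] (punchIn (fromℕ n) i)))
      (<-irrefl (Fin.toℕ-fromℕ n))

    before : ∀ b i → punchIn (slot b β) i Fin.< slot b β → Precedes (b ∷ β) (suc (lookup π i)) zero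
    before false i i<p = inj₁ (trans (lookup-arrange β i)
      (trans (sym (pivot-<ᵇ-punchIn (zeros β) i)) (<ᵇ-false (<⇒≤ i<p))) , s≤s z≤n)
    before true  i i<p with lookup β (lookup π i)
    ... | false = inj₂ (refl , refl)
    ... | true  = inj₁ (refl , s≤s z≤n)

  -- Pigeonhole: if v were missed, `punchOut` would map the n + 1 positions injectively into n
  -- values.
  lookup-surjective : ∀ {n} (π : Vec (Fin n) n) → IsPermutation π → ∀ v → ∃[ j ] lookup π j ≡ v
  lookup-surjective {suc n} π inj v with Fin.any? (λ j → lookup π j Fin.≟ v)
  ... | yes found  = found
  ... | no  missed = contradiction (Fin.injective⇒≤ {f = λ j → punchOut (avoid j)}
                       (λ {i} {j} eq → inj (Fin.punchOut-injective (avoid i) (avoid j) eq))) 1+n≰n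
    where
    avoid : ∀ j → v ≢ lookup π j
    avoid j eq = missed (j , sym eq)

  -- Strong induction on the position j. Agreement to the left of j and injectivity force π j to
  -- occur in ρ at some m ≥ j, and ρ j in π at some l ≥ j. If both inequalities were strict, each of
  -- the two values would precede the other.
  sorted-unique : ∀ {n} (β : Vec Bool n) {π ρ} → Sorted β π → Sorted β ρ → π ≡ ρ
  sorted-unique β {π} {ρ} sortedπ sortedρ =
    trans (sym (tabulate∘lookup π))
      (trans (tabulate-cong (λ j → agree j (<-wellFounded j))) (tabulate∘lookup ρ))
    where
    injπ : IsPermutation π
    injπ = sorted⇒permutation β π sortedπ
    injρ : IsPermutation ρ
    injρ = sorted⇒permutation β ρ sortedρ

    agree : ∀ j → Acc Fin._<_ j → lookup π j ≡ lookup ρ j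
    agree j (acc rs)
      with m , ρm≡πj ← lookup-surjective ρ injρ (lookup π j)
      with l , πl≡ρj ← lookup-surjective π injπ (lookup ρ j)
      with Fin.<-cmp m j | Fin.<-cmp l j
    ... | tri≈ _ refl _ | _             = sym ρm≡πj
    ... | tri< m<j m≢j _ | _            = contradiction (injπ (trans (agree m (rs m<j)) ρm≡πj)) m≢j
    ... | tri> _ _ _    | tri≈ _ refl _ = πl≡ρj
    ... | tri> _ _ _    | tri< l<j l≢j _ =
      contradiction (injρ (trans (sym (agree l (rs l<j))) πl≡ρj)) l≢j
    ... | tri> _ _ j<m  | tri> _ _ j<l  =
      contradiction (subst (Precedes β _) πl≡ρj (sortedπ j<l))
        (precedes-asym β (subst (Precedes β _) ρm≡πj (sortedρ j<m)))

  -- The three statistics of an arrangement.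

  1+nC2 : ∀ m → m + m C 2 ≡ suc m C 2
  1+nC2 m = trans (cong (_+ m C 2) (sym (nC1≡n m))) (nCk+nC[k+1]≡[n+1]C[k+1] m 1)

  -- The non-inversions are the pairs of a false value below a true one. Among all pairs of opposite
  -- letters, the remaining ones are counted by `binaryInv α`. The identity is kept free of
  -- subtraction and proved by adding the least value.
  inv-arrange : ∀ {m} (α : Vec Bool m) →
                inv (arrange α) + ones α * toℕ (zeros α) ≡ m C 2 + binaryInv α
  inv-arrange [] = refl
  inv-arrange {suc m} (b ∷ α) = begin
    inv (arrange (b ∷ α)) + ones (b ∷ α) * toℕ (zeros (b ∷ α))
      ≡⟨ cong₂ (λ x y → x + y * toℕ (zeros (b ∷ α))) (inv-insertMin (slot b α) (arrange α)) (ones-∷ b α) ⟩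
    toℕ (slot b α) + inv (arrange α) + (𝟙 b + ones α) * toℕ (zeros (b ∷ α))
      ≡⟨ step b ⟩
    m + (inv (arrange α) + ones α * z) + jump b
      ≡⟨ cong (λ x → m + x + jump b) (inv-arrange α) ⟩
    m + (m C 2 + binaryInv α) + jump b
      ≡⟨ regroup m (m C 2) (binaryInv α) (jump b) ⟩
    m + m C 2 + (jump b + binaryInv α)
      ≡⟨ cong₂ _+_ (1+nC2 m) (sym (binaryInv-∷ b)) ⟩
    suc m C 2 + binaryInv (b ∷ α) ∎
    where
    open ≡-Reasoning
    z = toℕ (zeros α)

    jump : Bool → ℕ
    jump b = if b then z else 0

    binaryInv-∷ : ∀ b → binaryInv (b ∷ α) ≡ jump b + binaryInv α
    binaryInv-∷ false = binaryInv-∷-false α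
    binaryInv-∷ true  = binaryInv-∷-true α

    regroup : ∀ m c i j → m + (c + i) + j ≡ m + c + (j + i)
    regroup = solve-∀

    step : ∀ b → toℕ (slot b α) + inv (arrange α) + (𝟙 b + ones α) * toℕ (zeros (b ∷ α)) ≡
                 m + (inv (arrange α) + ones α * z) + jump b
    -- The z new inversions and the s new pairs of opposite letters together make up m.
    step false = trans (expand z (inv (arrange α)) (ones α))
      (cong (λ x → x + (inv (arrange α) + ones α * z) + 0) (ones+zeros α))
      where
      expand : ∀ z i s → z + i + s * suc z ≡ s + z + (i + s * z) + 0
      expand = solve-∀
    -- Here the least value comes last and gives all m inversions; the z new pairs of opposite
    -- letters are `jump true`.
    step true = trans
      (cong₂ (λ x y → x + inv (arrange α) + suc (ones α) * y) (Fin.toℕ-fromℕ m) (Fin.toℕ-inject₁ (zeros α)))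
      (expand m z (inv (arrange α)) (ones α))
      where
      expand : ∀ m z i s → m + i + suc s * z ≡ m + (i + s * z) + z
      expand = solve-∀

  -- The leading false puts the entry 1 at the end of the false block, so exactly the true block
  -- follows it.
  afterone-arrange : ∀ {m} (α : Vec Bool m) → afterone (arrange (false ∷ α)) ≡ ones α
  afterone-arrange α = +-cancelʳ-≡ (toℕ (zeros α)) _ _
    (trans (afterone-insertMin (zeros α) (arrange α)) (sym (ones+zeros α)))

  ones≤length : ∀ {m} (α : Vec Bool m) → ones α ≤ m
  ones≤length α = m+n≤o⇒m≤o (ones α) (≤-reflexive (ones+zeros α))

  -- The entry 1 adds z inversions to those of `inv-arrange`. Since n = s + z + 1, adding n s to
  -- both sides turns the product s z into the square of s, and `exponent-exact` makes the truncated
  -- difference genuine.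
  inv-arrange-false : ∀ {m} (α : Vec Bool m) → let n = suc m; s = ones α in
    inv (arrange (false ∷ α)) ≡ (s ^ 2 + n C 2 ∸ n * s) + binaryInv α
  inv-arrange-false {m} α = +-cancelʳ-≡ (n * s) _ _ (begin
    inv (arrange (false ∷ α)) + n * s
      ≡⟨ cong₂ (λ x y → x + suc y * s) (inv-insertMin (zeros α) (arrange α)) (sym (ones+zeros α)) ⟩
    z + inv (arrange α) + suc (s + z) * s
      ≡⟨ regroup₁ z (inv (arrange α)) s ⟩
    inv (arrange α) + s * z + (s * s + (s + z))
      ≡⟨ cong₂ (λ x y → x + (s * s + y)) (inv-arrange α) (ones+zeros α) ⟩
    m C 2 + binaryInv α + (s * s + m)
      ≡⟨ regroup₂ (m C 2) (binaryInv α) s m ⟩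
    s ^ 2 + (m + m C 2) + binaryInv α
      ≡⟨ cong (λ x → s ^ 2 + x + binaryInv α) (1+nC2 m) ⟩
    s ^ 2 + n C 2 + binaryInv α
      ≡⟨ cong (_+ binaryInv α) (sym (m∸n+n≡m (exponent-exact {n} {s} (m≤n⇒m≤1+n (ones≤length α))))) ⟩
    (s ^ 2 + n C 2 ∸ n * s) + n * s + binaryInv α
      ≡⟨ regroup₃ (s ^ 2 + n C 2 ∸ n * s) (n * s) (binaryInv α) ⟩
    (s ^ 2 + n C 2 ∸ n * s) + binaryInv α + n * s ∎)
    where
    open ≡-Reasoning
    n = suc m
    s = ones α
    z = toℕ (zeros α)

    regroup₁ : ∀ z i s → z + i + suc (s + z) * s ≡ i + s * z + (s * s + (s + z))
    regroup₁ = solve-∀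

    regroup₂ : ∀ c i s m → c + i + (s * s + m) ≡ s * (s * 1) + (m + c) + i
    regroup₂ = solve-∀

    regroup₃ : ∀ a b c → a + b + c ≡ a + c + b
    regroup₃ = solve-∀

  -- The final 0 is inverted with all s ones, which yields the extra s in the exponent; exactness of
  -- the difference lets this s move inside it.
  inv-arrange-∷ʳ-false : ∀ {m} (α : Vec Bool m) → let n = suc (suc m); s = ones α in
    inv (arrange (false ∷ (α ∷ʳ false))) ≡ (s ^ 2 + s + n C 2 ∸ n * s) + binaryInv α
  inv-arrange-∷ʳ-false {m} α = begin
    inv (arrange (false ∷ (α ∷ʳ false)))
      ≡⟨ inv-arrange-false (α ∷ʳ false) ⟩
    (ones (α ∷ʳ false) ^ 2 + n C 2 ∸ n * ones (α ∷ʳ false)) + binaryInv (α ∷ʳ false)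
      ≡⟨ cong₂ (λ x y → (x ^ 2 + n C 2 ∸ n * x) + y) (ones-∷ʳ α false) (binaryInv-∷ʳ-false α) ⟩
    (s ^ 2 + n C 2 ∸ n * s) + (s + binaryInv α)
      ≡⟨ sym (+-assoc (s ^ 2 + n C 2 ∸ n * s) s (binaryInv α)) ⟩
    (s ^ 2 + n C 2 ∸ n * s) + s + binaryInv α
      ≡⟨ cong (_+ binaryInv α)
           (sym (+-∸-comm s (exponent-exact {n} {s} (≤-trans (ones≤length α) (m≤n+m m 2))))) ⟩
    (s ^ 2 + n C 2 + s ∸ n * s) + binaryInv α
      ≡⟨ cong (λ x → (x ∸ n * s) + binaryInv α) (xy∙z≈xz∙y (s ^ 2) (n C 2) s) ⟩
    (s ^ 2 + s + n C 2 ∸ n * s) + binaryInv α ∎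
    where
    open ≡-Reasoning
    n = suc (suc m)
    s = ones α

  inv-arrange-∷ʳ-true : ∀ {m} (α : Vec Bool m) → let n = suc (suc m); s = suc (ones α) in
    inv (arrange (false ∷ (α ∷ʳ true))) ≡ (s ^ 2 + n C 2 ∸ n * s) + binaryInv α
  inv-arrange-∷ʳ-true {m} α = trans (inv-arrange-false (α ∷ʳ true))
    (cong₂ (λ x y → (x ^ 2 + suc (suc m) C 2 ∸ suc (suc m) * x) + y)
      (ones-∷ʳ α true) (binaryInv-∷ʳ-true α))

  -- The greatest value is false, so it opens the arrangement and hides everything else. In the
  -- induction no smaller value is ever inserted in front.
  lrmax-arrange-∷ʳ-false : ∀ {m} (α : Vec Bool m) → lrmax (arrange (α ∷ʳ false)) ≡ 1
  lrmax-arrange-∷ʳ-false []      = refl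
  lrmax-arrange-∷ʳ-false (b ∷ α) = trans (lrmax-insertMin (slot b (α ∷ʳ false)) (arrange (α ∷ʳ false)))
    (cong₂ (λ x y → 𝟙 x + y) (slot≢0 b) (lrmax-arrange-∷ʳ-false α))
    where
    slot≢0 : ∀ b → (toℕ (slot b (α ∷ʳ false)) <ᵇ 1) ≡ false
    slot≢0 false rewrite zeros-∷ʳ-false α = refl
    slot≢0 true  = refl

  -- The correction term vanishes as soon as some letter is false; it is there
  -- because a word without false letters is arranged into a decreasing sequence.
  lrmax-arrange-∷ʳ-true : ∀ {m} (α : Vec Bool m) →
                          lrmax (arrange (α ∷ʳ true)) + 𝟙 (toℕ (zeros (α ∷ʳ true)) <ᵇ 1) ≡ 2
  lrmax-arrange-∷ʳ-true []      = refl
  lrmax-arrange-∷ʳ-true (b ∷ α) = trans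
    (cong (_+ 𝟙 (toℕ (zeros (b ∷ (α ∷ʳ true))) <ᵇ 1))
      (lrmax-insertMin (slot b (α ∷ʳ true)) (arrange (α ∷ʳ true))))
    (step b)
    where
    step : ∀ b → 𝟙 (toℕ (slot b (α ∷ʳ true)) <ᵇ 1) + lrmax (arrange (α ∷ʳ true)) +
                 𝟙 (toℕ (zeros (b ∷ (α ∷ʳ true))) <ᵇ 1) ≡ 2
    step false = trans (+-identityʳ _)
      (trans (+-comm (𝟙 (toℕ (zeros (α ∷ʳ true)) <ᵇ 1)) _) (lrmax-arrange-∷ʳ-true α))
    step true rewrite Fin.toℕ-inject₁ (zeros (α ∷ʳ true)) = lrmax-arrange-∷ʳ-true α

  -- Arrangements are exactly the Fishburn permutations avoiding 123.

  arrange-fishburn : ∀ {m} (α : Vec Bool m) → Fishburn123 (arrange (false ∷ α))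
  arrange-fishburn α = sorted⇒permutation β π sorted , no-fishburn , no-123
    where
    β = false ∷ α
    π = arrange β

    sorted : Sorted β π
    sorted = arrange-sorted β

    false≢true : ∀ {b} → b ≡ false → ¬ b ≡ true
    false≢true refl ()

    -- Values decrease within a block, so an ascent crosses from the false block to the true one.
    -- The middle entry of a 123 would therefore carry both letters.
    ascent : ∀ {j k} → j Fin.< k → π ! j < π ! k →
             lookup β (lookup π j) ≡ false × lookup β (lookup π k) ≡ true
    ascent j<k πj<πk with sorted j<k
    ... | inj₁ (_ , πk<πj) = contradiction (ℕ.s≤s⁻¹ πj<πk) (<-asym πk<πj)
    ... | inj₂ ft          = ft

    no-123 : ¬ Contains123 π
    no-123 (i , j , k , i<j , j<k , πi<πj , πj<πk) =
      false≢true (proj₁ (ascent j<k πj<πk)) (proj₂ (ascent i<j πi<πj))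

    no-fishburn : ¬ ContainsFishburnPattern π
    no-fishburn (j , j′ , k , j′≡1+j , j′<k , πj≡πk+1 , πj<πj′)
      with z , πz≡0 ← lookup-surjective π (sorted⇒permutation β π sorted) zero
      with βπj , βπj′ ← ascent {j} {j′} (≤-reflexive (sym j′≡1+j)) πj<πj′
      = compare (Fin.<-cmp z j) (Fin.<-cmp j′ z)
      where
      βπz : lookup β (lookup π z) ≡ false
      βπz = cong (lookup β) πz≡0

      -- The entry 1, at z, closes the false block, so z is not left of the false j and lies left of
      -- the true j′. These are neighbours, hence z = j; but then no entry is one below `π ! j`.
      compare : Tri (z Fin.< j) (z ≡ j) (j Fin.< z) → Tri (j′ Fin.< z) (j′ ≡ z) (z Fin.< j′) → _
      compare (tri≈ _ refl _) _ = contradiction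
        (trans (sym (cong toℕ πz≡0)) (trans (suc-injective πj≡πk+1) (+-comm _ 1))) λ ()
      compare (tri< z<j _ _) _ with sorted z<j
      ... | inj₁ (_ , πj<πz) = contradiction (subst (λ v → lookup π j Fin.< v) πz≡0 πj<πz) n≮0
      ... | inj₂ (_ , t)     = false≢true βπj t
      compare (tri> _ _ j<z) (tri≈ _ refl _) = false≢true βπz βπj′
      compare (tri> _ _ j<z) (tri> _ _ z<j′) =
        contradiction (subst (toℕ z <_) j′≡1+j z<j′) (≤⇒≯ j<z)
      compare (tri> _ _ j<z) (tri< j′<z _ _) with sorted j′<z
      ... | inj₁ (e , _) = false≢true (trans e βπz) βπj′
      ... | inj₂ (f , _) = false≢true f βπj′

  -- The word marks as true the values standing to the right of the entry 1. For this word π turns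
  -- out to be `Sorted`, and `sorted-unique` identifies it with the arrangement.
  Fishburn123⇒arrange : ∀ {m} (π : Vec (Fin (suc m)) (suc m)) → Fishburn123 π →
                        ∃[ α ] π ≡ arrange (false ∷ α)
  Fishburn123⇒arrange {m} π (perm , no-fishburn , no-123) =
    α , sorted-unique β sorted (arrange-sorted β)
    where
    position : Fin (suc m) → Fin (suc m)
    position v = proj₁ (lookup-surjective π perm v)
    p = position zero
    πp≡0 = proj₂ (lookup-surjective π perm zero)

    α = Vec.tabulate (λ v → does (p Fin.<? position (suc v)))
    β = false ∷ α

    lookup-β : ∀ v → lookup β v ≡ does (p Fin.<? position v)
    lookup-β zero    = sym (<ᵇ-false (≤-refl {toℕ p}))
    lookup-β (suc v) = lookup∘tabulate _ v

    lookup-β-π : ∀ j → lookup β (lookup π j) ≡ (toℕ p <ᵇ toℕ j)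
    lookup-β-π j = trans (lookup-β (lookup π j))
      (cong (λ i → toℕ p <ᵇ toℕ i) (perm (proj₂ (lookup-surjective π perm (lookup π j)))))

    after : ∀ {j} → p Fin.< j → lookup β (lookup π j) ≡ true
    after {j} p<j = trans (lookup-β-π j) (<ᵇ-true p<j)

    upto : ∀ {j} → ¬ p Fin.< j → lookup β (lookup π j) ≡ false
    upto {j} p≮j = trans (lookup-β-π j) (<ᵇ-false (≮⇒≥ p≮j))

    positive : ∀ {j} → j ≢ p → 0 < toℕ (lookup π j)
    positive {j} j≢p with lookup π j in eq
    ... | zero  = contradiction (perm (trans eq (sym πp≡0))) j≢p
    ... | suc v = s≤s z≤n

    descent : ∀ {j k} → j Fin.< k → ¬ π ! j < π ! k → lookup π k Fin.< lookup π j
    descent {j} {k} j<k πj≮πk with Fin.<-cmp (lookup π j) (lookup π k)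
    ... | tri< lt _ _ = contradiction (s≤s lt) πj≮πk
    ... | tri≈ _ eq _ = contradiction (perm eq) (Fin.<⇒≢ j<k)
    ... | tri> _ _ gt = gt

    -- An ascent between neighbours can start only at the entry 1.
    adjacent : ∀ {j j′} → toℕ j′ ≡ suc (toℕ j) → j ≢ p → ¬ π ! j < π ! j′
    adjacent {j} {j′} j′≡1+j j≢p πj<πj′ = go (lookup π j) refl
      where
      go : ∀ v → lookup π j ≡ v → _
      go zero    eq = contradiction (perm (trans eq (sym πp≡0))) j≢p
      go (suc v) eq = compare (Fin.<-cmp k j) (Fin.<-cmp j′ k)
        where
        -- The position of the value one below that at j, which exists because j is not the position
        -- of `zero`.
        k = proj₁ (lookup-surjective π perm (inject₁ v))

        πj≡1+πk : toℕ (lookup π j) ≡ suc (toℕ (lookup π k))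
        πj≡1+πk = trans (cong toℕ eq) (cong suc (sym (trans
          (cong toℕ (proj₂ (lookup-surjective π perm (inject₁ v)))) (Fin.toℕ-inject₁ v))))

        compare : Tri (k Fin.< j) (k ≡ j) (j Fin.< k) → Tri (j′ Fin.< k) (j′ ≡ k) (k Fin.< j′) → _
        compare (tri≈ _ k≡j _) _ =
          contradiction (trans (sym πj≡1+πk) (cong (toℕ ∘ lookup π) (sym k≡j))) 1+n≢n
        compare (tri< k<j _ _) _ =
          no-123 (k , j , j′ , k<j , ≤-reflexive (sym j′≡1+j) , s≤s (≤-reflexive (sym πj≡1+πk)) , πj<πj′)
        compare (tri> _ _ j<k) (tri≈ _ refl _) =
          contradiction (≤-trans (s≤s (n≤1+n _)) (subst (λ x → suc x < π ! k) πj≡1+πk πj<πj′)) (<-irrefl refl)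
        compare (tri> _ _ j<k) (tri> _ _ k<j′) =
          contradiction (subst (toℕ k <_) j′≡1+j k<j′) (≤⇒≯ j<k)
        compare (tri> _ _ j<k) (tri< j′<k _ _) =
          no-fishburn (j , j′ , k , j′≡1+j , j′<k , cong suc (trans πj≡1+πk (+-comm 1 _)) , πj<πj′)

    -- Descents between neighbours are chained; d is one less than the distance from j to k. As k ≤
    -- p, none of them starts at p, so `adjacent` applies to each.
    decreasing : ∀ d {j k} → suc (toℕ j + d) ≡ toℕ k → k Fin.≤ p → lookup π k Fin.< lookup π j
    decreasing zero {j} {k} eq k≤p = descent j<k
      (adjacent (trans (sym eq) (cong suc (+-identityʳ _))) (Fin.<⇒≢ (<-≤-trans j<k k≤p)))
      where
      j<k : j Fin.< k
      j<k = ≤-reflexive (trans (cong suc (sym (+-identityʳ _))) eq)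
    decreasing (suc d) {j} {k} eq k≤p = <-trans
      (decreasing d {j′} {k} (trans (cong (λ x → suc (x + d)) j′≡1+j) (trans (cong suc (sym (+-suc _ d))) eq)) k≤p)
      (decreasing zero {j} {j′} (trans (cong suc (+-identityʳ _)) (sym j′≡1+j))
        (≤-trans (≤-reflexive j′≡1+j) (<⇒≤ (<-≤-trans 1+j<k k≤p))))
      where
      1+j<k : suc (toℕ j) < toℕ k
      1+j<k = subst (suc (toℕ j) <_) eq (s≤s (m<m+n (toℕ j) (s≤s z≤n)))
      j′ = Fin.fromℕ< (<-trans 1+j<k (Fin.toℕ<n k))
      j′≡1+j : toℕ j′ ≡ suc (toℕ j)
      j′≡1+j = Fin.toℕ-fromℕ< (<-trans 1+j<k (Fin.toℕ<n k))

    sorted : Sorted β π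
    sorted {j} {k} j<k with p Fin.<? j | p Fin.<? k
    ... | yes p<j | yes p<k = inj₁ (trans (after p<j) (sym (after p<k)) ,
      descent j<k λ πj<πk → no-123 (p , j , k , p<j , j<k , first , πj<πk))
      where
      first : π ! p < π ! j
      first = s≤s (subst (λ v → toℕ v < toℕ (lookup π j)) (sym πp≡0) (positive (≢-sym (Fin.<⇒≢ p<j))))
    ... | yes p<j | no  p≮k = contradiction (<-trans p<j j<k) p≮k
    ... | no  p≮j | yes p<k = inj₂ (upto p≮j , after p<k)
    ... | no  p≮j | no  p≮k = inj₁ (trans (upto p≮j) (sym (upto p≮k)) ,
      decreasing (toℕ k ∸ suc (toℕ j)) (m+[n∸m]≡n j<k) (≮⇒≥ p≮k))

  -- The word can be read off: `zero` stands at position `zeros α`, and by `lookup-arrange` a value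
  -- is true exactly when it stands to the right of it.
  arrange-injective : ∀ {m} {α α′ : Vec Bool m} →
                      arrange (false ∷ α) ≡ arrange (false ∷ α′) → α ≡ α′
  arrange-injective {m} {α} {α′} eq = cong Vec.tail
    (trans (sym (tabulate∘lookup β)) (trans (tabulate-cong agree) (tabulate∘lookup β′)))
    where
    β = false ∷ α
    β′ = false ∷ α′

    perm : IsPermutation (arrange β)
    perm = sorted⇒permutation β (arrange β) (arrange-sorted β)

    zeros≡ : zeros α ≡ zeros α′
    zeros≡ = perm (trans (lookup-insertMin-pivot (zeros α) (arrange α))
      (sym (trans (cong (λ π → lookup π (zeros α′)) eq)
        (lookup-insertMin-pivot (zeros α′) (arrange α′)))))

    agree : ∀ v → lookup β v ≡ lookup β′ v
    agree v with j , refl ← lookup-surjective (arrange β) perm v = begin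
      lookup β (lookup (arrange β) j)    ≡⟨ lookup-arrange β j ⟩
      (suc (toℕ (zeros α)) <ᵇ suc (toℕ j))   ≡⟨ cong (λ z → suc (toℕ z) <ᵇ suc (toℕ j)) zeros≡ ⟩
      (suc (toℕ (zeros α′)) <ᵇ suc (toℕ j))  ≡⟨ sym (lookup-arrange β′ j) ⟩
      lookup β′ (lookup (arrange β′) j)  ≡⟨ cong (λ π → lookup β′ (lookup π j)) (sym eq) ⟩
      lookup β′ (lookup (arrange β) j)   ∎
      where open ≡-Reasoning

open Arrangements

bits : List Bool
bits = false ∷ true ∷ []

bits-complete : ∀ b → b ∈ bits
bits-complete false = here ≡.refl
bits-complete true  = there (here ≡.refl)

bits-unique : Unique bits
bits-unique = ((λ ()) ∷ []) ∷ [] ∷ []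

F123-↭ : ∀ m → F123 (suc m) ↭ List.map (λ α → arrange (false ∷ α)) (words bits m)
F123-↭ m = ∼bag⇒↭ (unique∧set⇒bag
  (Unique.filter⁺ fishburn123? (words-unique (Unique.allFin⁺ (suc m)) (suc m)))
  (Unique.map⁺ arrange-injective (words-unique bits-unique m))
  (mk⇔ to from))
  where
  to : ∀ {π} → π ∈ F123 (suc m) → π ∈ List.map (λ α → arrange (false ∷ α)) (words bits m)
  to {π} π∈F = ≡.subst (_∈ List.map (λ α → arrange (false ∷ α)) (words bits m)) (≡.sym (proj₂ preimage))
    (∈-map⁺ (λ α → arrange (false ∷ α)) (words-complete bits-complete (proj₁ preimage)))
    where
    preimage = Fishburn123⇒arrange π
      (proj₂ (∈-filter⁻ fishburn123? {xs = words (allFin (suc m)) (suc m)} π∈F))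

  from : ∀ {π} → π ∈ List.map (λ α → arrange (false ∷ α)) (words bits m) → π ∈ F123 (suc m)
  from {π} π∈map = ≡.subst (_∈ F123 (suc m)) (≡.sym (proj₂ (proj₂ preimage)))
    (∈-filter⁺ fishburn123? (words-complete ∈-allFin (arrange (false ∷ proj₁ preimage)))
      (arrange-fishburn (proj₁ preimage)))
    where
    preimage = ∈-map⁻ (λ α → arrange (false ∷ α)) π∈map

module _ {c ℓ} (R : CommutativeSemiring c ℓ) where
  open CommutativeSemiring R hiding (zero)
  open GeneratingFunctions R
  open import Algebra.Properties.Semiring.Exp semiring using (^-homo-*; ^-congʳ)
  open import Algebra.Properties.CommutativeSemigroup +-commutativeSemigroup
    using (interchange; x∙yz≈y∙xz)
  open import Relation.Binary.Reasoning.Setoid setoid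

  ∑-cong : ∀ {a} {A : Set a} {f g : A → Carrier} → (∀ x → f x ≈ g x) →
           ∀ xs → ∑ xs f ≈ ∑ xs g
  ∑-cong f≈g []       = refl
  ∑-cong f≈g (x ∷ xs) = +-cong (f≈g x) (∑-cong f≈g xs)

  ∑-↭ : ∀ {a} {A : Set a} (f : A → Carrier) {xs ys} → xs ↭ ys → ∑ xs f ≈ ∑ ys f
  ∑-↭ f Perm.refl         = refl
  ∑-↭ f (Perm.prep x p)   = +-congˡ (∑-↭ f p)
  ∑-↭ f (Perm.swap x y p) = trans (x∙yz≈y∙xz _ _ _) (+-congˡ (+-congˡ (∑-↭ f p)))
  ∑-↭ f (Perm.trans p q)  = trans (∑-↭ f p) (∑-↭ f q)

  ∑-map : ∀ {a b} {A : Set a} {B : Set b} (f : B → Carrier) (g : A → B) xs →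
          ∑ (List.map g xs) f ≈ ∑ xs (f ∘ g)
  ∑-map f g []       = refl
  ∑-map f g (x ∷ xs) = +-congˡ (∑-map f g xs)

  ∑-++ : ∀ {a} {A : Set a} (f : A → Carrier) xs ys → ∑ (xs List.++ ys) f ≈ ∑ xs f + ∑ ys f
  ∑-++ f []       ys = sym (+-identityˡ _)
  ∑-++ f (x ∷ xs) ys = trans (+-congˡ (∑-++ f xs ys)) (sym (+-assoc _ _ _))

  ∑-+ : ∀ {a} {A : Set a} (f g : A → Carrier) xs → ∑ xs (λ x → f x + g x) ≈ ∑ xs f + ∑ xs g
  ∑-+ f g []       = sym (+-identityˡ _)
  ∑-+ f g (x ∷ xs) = trans (+-congˡ (∑-+ f g xs)) (interchange _ _ _ _)

  ∑-*ˡ : ∀ {a} {A : Set a} u (f : A → Carrier) xs → ∑ xs (λ x → u * f x) ≈ u * ∑ xs f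
  ∑-*ˡ u f []       = sym (zeroʳ u)
  ∑-*ˡ u f (x ∷ xs) = trans (+-congˡ (∑-*ˡ u f xs)) (sym (distribˡ _ _ _))

  ∑-*ʳ : ∀ {a} {A : Set a} (f : A → Carrier) u xs → ∑ xs (λ x → f x * u) ≈ ∑ xs f * u
  ∑-*ʳ f u []       = sym (zeroˡ u)
  ∑-*ʳ f u (x ∷ xs) = trans (+-congˡ (∑-*ʳ f u xs)) (sym (distribʳ _ _ _))

  ∑-0 : ∀ {a} {A : Set a} (xs : List A) → ∑ xs (λ _ → 0#) ≈ 0#
  ∑-0 []       = refl
  ∑-0 (x ∷ xs) = trans (+-identityˡ _) (∑-0 xs)

  when : Bool → Carrier → Carrier
  when b u = if b then u else 0#

  ∑-filter-∷ : ∀ {a p} {A : Set a} {P : Pred A p} (P? : Decidable P) (f : A → Carrier) x xs →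
               ∑ (filter P? (x ∷ xs)) f ≈ when (does (P? x)) (f x) + ∑ (filter P? xs) f
  ∑-filter-∷ P? f x xs with does (P? x)
  ... | true  = refl
  ... | false = sym (+-identityˡ _)

  ∑-filter-cong : ∀ {a p} {A : Set a} {P : Pred A p} (P? : Decidable P) {f g : A → Carrier} →
                  (∀ {x} → P x → f x ≈ g x) → ∀ xs → ∑ (filter P? xs) f ≈ ∑ (filter P? xs) g
  ∑-filter-cong P? f≈g []       = refl
  ∑-filter-cong P? f≈g (x ∷ xs) with P? x
  ... | yes px = +-cong (f≈g px) (∑-filter-cong P? f≈g xs)
  ... | no  _  = ∑-filter-cong P? f≈g xs

  ∑-upTo-cong : ∀ {f g : ℕ → Carrier} (h k : ℕ → ℕ) n → (∀ i → f (h i) ≈ g (k i)) →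
                ∑ (applyUpTo h n) f ≈ ∑ (applyUpTo k n) g
  ∑-upTo-cong h k zero    eq = refl
  ∑-upTo-cong h k (suc n) eq = +-cong (eq 0) (∑-upTo-cong (h ∘ suc) (k ∘ suc) n (eq ∘ suc))

  ∑-upTo-single : ∀ {N} (h : ℕ → ℕ) → (∀ {i j} → h i ≡ h j → i ≡ j) → ∀ {i} → i < N → ∀ u →
                  ∑ (applyUpTo h N) (λ s → when (does (h i ℕ.≟ s)) u) ≈ u
  ∑-upTo-single {suc N} h h-inj {zero} i<N u = trans
    (+-cong (reflexive (≡.cong (λ b → when b u) (dec-true (h 0 ℕ.≟ h 0) ≡.refl)))
      (trans
        (∑-upTo-cong {g = λ _ → 0#} (h ∘ suc) id N (λ j → reflexive (≡.cong (λ b → when b u)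
          (dec-false (h 0 ℕ.≟ h (suc j)) (λ eq → contradiction (h-inj eq) λ ())))))
        (∑-0 (applyUpTo id N))))
    (+-identityʳ u)
  ∑-upTo-single {suc N} h h-inj {suc i} (s≤s i<N) u = trans
    (+-cong
      (reflexive (≡.cong (λ b → when b u)
        (dec-false (h (suc i) ℕ.≟ h 0) (λ eq → contradiction (h-inj eq) λ ()))))
      (∑-upTo-single (h ∘ suc) (ℕ.suc-injective ∘ h-inj) i<N u))
    (+-identityˡ u)

  ∑-fibres : ∀ {a} {A : Set a} (κ : A → ℕ) {N} → (∀ x → κ x < N) → (f : A → Carrier) → ∀ xs →
             ∑ xs f ≈ ∑[ s ∈ applyUpTo id N ] (∑ (filter (λ x → κ x ℕ.≟ s) xs) f)
  ∑-fibres κ {N} κ<N f []       = sym (∑-0 (applyUpTo id N))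
  ∑-fibres κ {N} κ<N f (x ∷ xs) = begin
    f x + ∑ xs f
      ≈⟨ +-cong (sym (∑-upTo-single id id (κ<N x) (f x))) (∑-fibres κ κ<N f xs) ⟩
    ∑ (applyUpTo id N) (λ s → when (does (κ x ℕ.≟ s)) (f x)) +
    ∑ (applyUpTo id N) (λ s → ∑ (filter (λ x → κ x ℕ.≟ s) xs) f)
      ≈⟨ sym (∑-+ _ _ (applyUpTo id N)) ⟩
    ∑ (applyUpTo id N) (λ s → when (does (κ x ℕ.≟ s)) (f x) + ∑ (filter (λ x → κ x ℕ.≟ s) xs) f)
      ≈⟨ ∑-cong (λ s → sym (∑-filter-∷ (λ x → κ x ℕ.≟ s) f x xs)) (applyUpTo id N) ⟩
    ∑ (applyUpTo id N) (λ s → ∑ (filter (λ x → κ x ℕ.≟ s) (x ∷ xs)) f) ∎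

  ∑-by-ones : ∀ q (e : ℕ → ℕ) (ρ : ℕ → Carrier) m →
    ∑ (words bits m) (λ α → q ^ᴿ (e (ones α) ℕ.+ binaryInv α) * ρ (ones α)) ≈
    (∑[ s ∈ applyUpTo id (suc m) ] (q ^ᴿ e s * qBinomial q m s * ρ s))
  ∑-by-ones q e ρ m = trans
    (∑-fibres ones (s≤s ∘ ones≤length) _ (words bits m))
    (∑-cong fibre (applyUpTo id (suc m)))
    where
    fibre : ∀ s → ∑ (binarySequences m s) (λ α → q ^ᴿ (e (ones α) ℕ.+ binaryInv α) * ρ (ones α)) ≈
                  q ^ᴿ e s * qBinomial q m s * ρ s
    fibre s = begin
      ∑ (binarySequences m s) (λ α → q ^ᴿ (e (ones α) ℕ.+ binaryInv α) * ρ (ones α))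
        ≈⟨ ∑-filter-cong (λ α → ones α ℕ.≟ s) (λ {α} eq → term {α} eq) (words bits m) ⟩
      ∑ (binarySequences m s) (λ α → q ^ᴿ e s * q ^ᴿ binaryInv α * ρ s)
        ≈⟨ ∑-*ʳ (λ α → q ^ᴿ e s * q ^ᴿ binaryInv α) (ρ s) (binarySequences m s) ⟩
      ∑ (binarySequences m s) (λ α → q ^ᴿ e s * q ^ᴿ binaryInv α) * ρ s
        ≈⟨ *-congʳ (∑-*ˡ (q ^ᴿ e s) (λ α → q ^ᴿ binaryInv α) (binarySequences m s)) ⟩
      q ^ᴿ e s * qBinomial q m s * ρ s ∎
      where
      term : ∀ {α} → ones α ≡ s →
             q ^ᴿ (e (ones α) ℕ.+ binaryInv α) * ρ (ones α) ≈ q ^ᴿ e s * q ^ᴿ binaryInv α * ρ s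
      term {α} ≡.refl = *-congʳ (^-homo-* q (e (ones α)) (binaryInv α))

  ∑-words-∷ : ∀ m (f : Vec Bool (suc m) → Carrier) →
    ∑ (words bits (suc m)) f ≈ ∑ (words bits m) (f ∘ (false ∷_)) + ∑ (words bits m) (f ∘ (true ∷_))
  ∑-words-∷ m f = trans (∑-++ f (List.map (false ∷_) W) _)
    (+-cong (∑-map f (false ∷_) W)
      (trans (∑-++ f (List.map (true ∷_) W) []) (trans (+-identityʳ _) (∑-map f (true ∷_) W))))
    where
    W = words bits m

  ∑-words-∷ʳ : ∀ m (f : Vec Bool (suc m) → Carrier) →
    ∑ (words bits (suc m)) f ≈ ∑ (words bits m) (f ∘ (_∷ʳ false)) + ∑ (words bits m) (f ∘ (_∷ʳ true))
  ∑-words-∷ʳ zero    f = ∑-words-∷ zero f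
  ∑-words-∷ʳ (suc m) f = begin
    ∑ (words bits (suc (suc m))) f
      ≈⟨ ∑-words-∷ (suc m) f ⟩
    ∑ (words bits (suc m)) (f ∘ (false ∷_)) + ∑ (words bits (suc m)) (f ∘ (true ∷_))
      ≈⟨ +-cong (∑-words-∷ʳ m (f ∘ (false ∷_))) (∑-words-∷ʳ m (f ∘ (true ∷_))) ⟩
    (∑ (words bits m) (λ α → f (false ∷ (α ∷ʳ false))) + ∑ (words bits m) (λ α → f (false ∷ (α ∷ʳ true)))) +
    (∑ (words bits m) (λ α → f (true ∷ (α ∷ʳ false))) + ∑ (words bits m) (λ α → f (true ∷ (α ∷ʳ true))))
      ≈⟨ interchange _ _ _ _ ⟩
    (∑ (words bits m) (λ α → f (false ∷ (α ∷ʳ false))) + ∑ (words bits m) (λ α → f (true ∷ (α ∷ʳ false)))) +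
    (∑ (words bits m) (λ α → f (false ∷ (α ∷ʳ true))) + ∑ (words bits m) (λ α → f (true ∷ (α ∷ʳ true))))
      ≈⟨ sym (+-cong (∑-words-∷ m (f ∘ (_∷ʳ false))) (∑-words-∷ m (f ∘ (_∷ʳ true)))) ⟩
    ∑ (words bits (suc m)) (f ∘ (_∷ʳ false)) + ∑ (words bits (suc m)) (f ∘ (_∷ʳ true)) ∎

  ∑-F123 : ∀ m (f : Vec (Fin (suc m)) (suc m) → Carrier) →
           ∑ (F123 (suc m)) f ≈ ∑ (words bits m) (λ α → f (arrange (false ∷ α)))
  ∑-F123 m f = trans (∑-↭ f (F123-↭ m)) (∑-map f (λ α → arrange (false ∷ α)) (words bits m))

  ∑-inv-afterone : ∀ m q r → let n = suc m in
    ∑ (F123 n) (λ π → q ^ᴿ inv π * r ^ᴿ afterone π) ≈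
    (∑[ s ∈ range 0 m ] (q ^ᴿ (s ℕ.^ 2 ℕ.+ n C 2 ∸ n ℕ.* s) * qBinomial q m s * r ^ᴿ s))
  ∑-inv-afterone m q r = begin
    ∑ (F123 n) (λ π → q ^ᴿ inv π * r ^ᴿ afterone π)
      ≈⟨ ∑-F123 m (λ π → q ^ᴿ inv π * r ^ᴿ afterone π) ⟩
    ∑ (words bits m) (λ α → q ^ᴿ inv (arrange (false ∷ α)) * r ^ᴿ afterone (arrange (false ∷ α)))
      ≈⟨ ∑-cong (λ α → *-cong (^-congʳ q (inv-arrange-false α)) (^-congʳ r (afterone-arrange α)))
           (words bits m) ⟩
    ∑ (words bits m) (λ α → q ^ᴿ (e (ones α) ℕ.+ binaryInv α) * r ^ᴿ ones α)
      ≈⟨ ∑-by-ones q e (r ^ᴿ_) m ⟩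
    (∑[ s ∈ range 0 m ] (q ^ᴿ e s * qBinomial q m s * r ^ᴿ s)) ∎
    where
    n = suc m
    e : ℕ → ℕ
    e s = s ℕ.^ 2 ℕ.+ n C 2 ∸ n ℕ.* s

  ∑-inv-lrmax-afterone : ∀ m q t r → let n = suc (suc m) in
    ∑ (F123 n) (λ π → q ^ᴿ inv π * t ^ᴿ lrmax π * r ^ᴿ afterone π) ≈
    t * (∑[ s ∈ range 0 m ]
          (q ^ᴿ (s ℕ.^ 2 ℕ.+ s ℕ.+ n C 2 ∸ n ℕ.* s) * qBinomial q m s * r ^ᴿ s))
    + t ^ᴿ 2 * (∑[ s ∈ range 1 (suc m) ]
          (q ^ᴿ (s ℕ.^ 2 ℕ.+ n C 2 ∸ n ℕ.* s) * qBinomial q m (s ∸ 1) * r ^ᴿ s))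
  ∑-inv-lrmax-afterone m q t r = begin
    ∑ (F123 n) w
      ≈⟨ ∑-F123 (suc m) w ⟩
    ∑ (words bits (suc m)) (λ α → w (arrange (false ∷ α)))
      ≈⟨ ∑-words-∷ʳ m (λ α → w (arrange (false ∷ α))) ⟩
    ∑ (words bits m) (λ α → w (arrange (false ∷ (α ∷ʳ false)))) +
    ∑ (words bits m) (λ α → w (arrange (false ∷ (α ∷ʳ true))))
      ≈⟨ +-cong (∑-cong last-false (words bits m)) (∑-cong last-true (words bits m)) ⟩
    ∑ (words bits m) (λ α → t * (q ^ᴿ (e₁ (ones α) ℕ.+ binaryInv α) * r ^ᴿ ones α)) +
    ∑ (words bits m) (λ α → t ^ᴿ 2 * (q ^ᴿ (e₂ (suc (ones α)) ℕ.+ binaryInv α) * r ^ᴿ suc (ones α)))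
      ≈⟨ +-cong
           (trans (∑-*ˡ t _ (words bits m)) (*-congˡ (∑-by-ones q e₁ (r ^ᴿ_) m)))
           (trans (∑-*ˡ (t ^ᴿ 2) _ (words bits m)) (*-congˡ (trans
             (∑-by-ones q (e₂ ∘ suc) (λ s → r ^ᴿ suc s) m)
             (∑-upTo-cong id suc (suc m) (λ _ → refl))))) ⟩
    t * (∑[ s ∈ range 0 m ] (q ^ᴿ e₁ s * qBinomial q m s * r ^ᴿ s)) +
    t ^ᴿ 2 * (∑[ s ∈ range 1 (suc m) ] (q ^ᴿ e₂ s * qBinomial q m (s ∸ 1) * r ^ᴿ s)) ∎
    where
    open import Algebra.Properties.CommutativeSemigroup *-commutativeSemigroup using (xy∙z≈y∙xz)
    n = suc (suc m)

    e₁ e₂ : ℕ → ℕ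
    e₁ s = s ℕ.^ 2 ℕ.+ s ℕ.+ n C 2 ∸ n ℕ.* s
    e₂ s = s ℕ.^ 2 ℕ.+ n C 2 ∸ n ℕ.* s

    w : Vec (Fin n) n → Carrier
    w π = q ^ᴿ inv π * t ^ᴿ lrmax π * r ^ᴿ afterone π

    weight : ∀ π {i l a} → inv π ≡ i → lrmax π ≡ l → afterone π ≡ a →
             w π ≈ t ^ᴿ l * (q ^ᴿ i * r ^ᴿ a)
    weight π ≡.refl ≡.refl ≡.refl = xy∙z≈y∙xz _ _ _

    last-false : ∀ α → w (arrange (false ∷ (α ∷ʳ false))) ≈
                 t * (q ^ᴿ (e₁ (ones α) ℕ.+ binaryInv α) * r ^ᴿ ones α)
    last-false α = trans
      (weight (arrange (false ∷ (α ∷ʳ false))) (inv-arrange-∷ʳ-false α)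
        (lrmax-arrange-∷ʳ-false (false ∷ α))
        (≡.trans (afterone-arrange (α ∷ʳ false)) (ones-∷ʳ α false)))
      (*-congʳ (*-identityʳ t))

    last-true : ∀ α → w (arrange (false ∷ (α ∷ʳ true))) ≈
                t ^ᴿ 2 * (q ^ᴿ (e₂ (suc (ones α)) ℕ.+ binaryInv α) * r ^ᴿ suc (ones α))
    last-true α = weight (arrange (false ∷ (α ∷ʳ true))) (inv-arrange-∷ʳ-true α)
      (≡.trans (≡.sym (ℕ.+-identityʳ _)) (lrmax-arrange-∷ʳ-true (false ∷ α)))
      (≡.trans (afterone-arrange (α ∷ʳ true)) (ones-∷ʳ α true))

proposition4p7 : ∀ {c ℓ} (R : CommutativeSemiring c ℓ) →
    let open CommutativeSemiring R
        open GeneratingFunctions R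
    in
    (n : ℕ) → 2 ≤ n →
    (∀ (q t r : Carrier) →
      (∑[ π ∈ F123 n ] (q ^ᴿ inv π * t ^ᴿ lrmax π * r ^ᴿ afterone π))
      ≈ t * (∑[ s ∈ range 0 (n ∸ 2) ]
              (q ^ᴿ (s ℕ.^ 2 ℕ.+ s ℕ.+ (n C 2) ∸ n ℕ.* s) * qBinomial q (n ∸ 2) s * r ^ᴿ s))
        + t ^ᴿ 2 * (∑[ s ∈ range 1 (n ∸ 1) ]
              (q ^ᴿ (s ℕ.^ 2 ℕ.+ (n C 2) ∸ n ℕ.* s) * qBinomial q (n ∸ 2) (s ∸ 1) * r ^ᴿ s)))
    ×
    (∀ (q r : Carrier) →
      (∑[ π ∈ F123 n ] (q ^ᴿ inv π * r ^ᴿ afterone π))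
      ≈ (∑[ s ∈ range 0 (n ∸ 1) ]
          (q ^ᴿ (s ℕ.^ 2 ℕ.+ (n C 2) ∸ n ℕ.* s) * qBinomial q (n ∸ 1) s * r ^ᴿ s)))
proposition4p7 R (suc (suc m)) (s≤s (s≤s z≤n)) =
  ∑-inv-lrmax-afterone R m , ∑-inv-afterone R (suc m)
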